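{- Let $G^\sigma$ be a connected oriented unicyclic graph of order $n$ with girth $k$, where $n>k$. Then $sr(G^\sigma)\geq k$ if $k$ is even and $sr(G^\sigma)\geq k+1$ if $k$ is odd. This bound is sharp (it is attained, e.g., by every orientation of the graph obtained from $C_k$ by attaching $n-k$ pendant edges at one vertex of $C_k$).
   Context: An oriented graph $G^\sigma$ is a simple graph $G$ together with an orientation of each edge. Its skew-adjacency matrix $S(G^\sigma)=(s_{ij})$ has $s_{ij}=1$ if there is an arc from $v_i$ to $v_j$, $s_{ij}=-1$ if there is an arc from $v_j$ to $v_i$, and $0$ otherwise; the skew-rank $sr(G^\sigma)$ is the rank of $S(G^\sigma)$. A unicyclic graph is a connected graph with exactly one cycle; its girth is the length of that cycle. -}

module Defs where

open import Algebra.Bundles using (CommutativeRing)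
import Algebra.Properties.Semiring.Sum as Sum
open import Data.Bool.Base using (if_then_else_)
open import Data.Empty using (⊥)
open import Data.Fin.Base using (Fin; zero; suc; toℕ; punchIn; punchOut; splitAt; funToFin; finToFun)
open import Data.Fin.Properties as Fin using (any?; toℕ-fromℕ<; toℕ<n; punchIn-punchOut; finToFun-funToFin)
open import Data.Nat.Base as ℕ using (ℕ; z≤n; s≤s; _≤_; _<_)
open import Data.Nat.DivMod using (_mod_; m<n⇒m%n≡m; n%n≡0; m%n<n)
import Data.Nat.Properties as ℕ
open import Data.Product.Base using (∃; _×_; _,_; proj₁; proj₂)
open import Data.Rational.Base using (ℚ; 0ℚ; 1ℚ; _+_; _*_; _-_; -_; 1/_; ≢-nonZero)
open import Data.Rational.Properties using (_≟_; +-*-commutativeRing; *-inverseˡ; *-assoc; *-identityˡ; *-zeroʳ; *-zeroˡ; +-identityʳ)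
open import Data.Rational.Solver using (module +-*-Solver)
open import Data.Sum.Base using (_⊎_; inj₁; inj₂; [_,_]′; swap)
open import Data.Vec.Functional using (insertAt)
open import Data.Vec.Functional.Properties using (insertAt-lookup; insertAt-punchIn)
open import Function.Base using (_∘_)
open import Function.Bundles using (_⇔_; mk⇔; Equivalence)
open import Function.Construct.Symmetry using (⇔-sym)
open import Function.Definitions using (Injective)
open import Relation.Binary.Construct.Closure.ReflexiveTransitive using (Star)
open import Relation.Binary.Definitions using (Decidable; Symmetric; Irreflexive; Asymmetric)
open import Relation.Binary.PropositionalEquality
open import Relation.Nullary using (Dec; yes; no; ¬_; does; contradiction)
open import Relation.Nullary.Decidable as Dec using (_⊎-dec_; ¬?; decidable-stable)

open Sum (CommutativeRing.semiring +-*-commutativeRing) using (sum; sum-remove; sum-cong-≗; ∑-distrib-+; *-distribˡ-sum)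

Matrix : ℕ → ℕ → Set
Matrix m n = Fin m → Fin n → ℚ

_·_ : ∀ {m n} → Matrix m n → (Fin n → ℚ) → (Fin m → ℚ)
(A · x) i = sum (λ j → A i j * x j)

IndependentColumns : ∀ {m n} → Matrix m n → Set
IndependentColumns A = ∀ x → (∀ i → (A · x) i ≡ 0ℚ) → ∀ j → x j ≡ 0ℚ

columns : ∀ {m n s} → Matrix m n → (Fin s → Fin n) → Matrix m s
columns A c i = A i ∘ c

-- r is the maximum size of a linearly independent family of columns.  Such
-- a family never repeats a column, so c need not be required to be injective.
IsRank : ∀ {m n} → Matrix m n → ℕ → Set
IsRank {m} {n} A r =
    (∃ λ (c : Fin r → Fin n) → IndependentColumns (columns A c))
  × (∀ {s} (c : Fin s → Fin n) → IndependentColumns (columns A c) → s ≤ r)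

-- The existence of the rank is proved by deciding linear independence with
-- Gaussian elimination (fraction-free, so the pivot is never inverted).
private
  *-cancel-0 : ∀ a b → a ≢ 0ℚ → a * b ≡ 0ℚ → b ≡ 0ℚ
  *-cancel-0 a b a≢0 ab≡0 = begin
    b                ≡⟨ *-identityˡ b ⟨
    1ℚ * b           ≡⟨ cong (_* b) (*-inverseˡ a) ⟨
    (1/ a * a) * b   ≡⟨ *-assoc (1/ a) a b ⟩
    1/ a * (a * b)   ≡⟨ cong (1/ a *_) ab≡0 ⟩
    1/ a * 0ℚ        ≡⟨ *-zeroʳ (1/ a) ⟩
    0ℚ               ∎
    where
    open ≡-Reasoning
    instance _ = ≢-nonZero a≢0

  sum-zero : ∀ {n} (f : Fin n → ℚ) → (∀ j → f j ≡ 0ℚ) → sum f ≡ 0ℚ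
  sum-zero {ℕ.zero}  f f≡0 = refl
  sum-zero {ℕ.suc n} f f≡0 = cong₂ _+_ (f≡0 zero) (sum-zero (f ∘ suc) (f≡0 ∘ suc))

  independent-resp : ∀ {m n} {A B : Matrix m n} → (∀ i j → A i j ≡ B i j) →
                     IndependentColumns A → IndependentColumns B
  independent-resp A≗B ind x Bx≡0 =
    ind x λ i → trans (sum-cong-≗ (λ j → cong (_* x j) (A≗B i j))) (Bx≡0 i)

  dropRow : ∀ {m n} (A : Matrix (ℕ.suc m) n) → (∀ j → A zero j ≡ 0ℚ) →
            IndependentColumns A ⇔ IndependentColumns (A ∘ suc)
  dropRow A A₀≡0 = mk⇔
    (λ ind x Ax≡0 → ind x λ where
      zero    → sum-zero _ (λ j → trans (cong (_* x j) (A₀≡0 j)) (*-zeroˡ (x j)))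
      (suc i) → Ax≡0 i)
    (λ ind x Ax≡0 → ind x (Ax≡0 ∘ suc))

  module _ {m n} (A : Matrix (ℕ.suc m) (ℕ.suc n)) (p : Fin (ℕ.suc n)) where
    open ≡-Reasoning
    open +-*-Solver

    a : ℚ
    a = A zero p

    rest : Fin (ℕ.suc m) → (Fin n → ℚ) → ℚ
    rest i y = sum (λ j → A i (punchIn p j) * y j)

    eliminate : Matrix m n
    eliminate i j = a * A (suc i) (punchIn p j) + (- A (suc i) p) * A zero (punchIn p j)

    split : ∀ x i → (A · x) i ≡ A i p * x p + rest i (x ∘ punchIn p)
    split x i = sum-remove {i = p} (λ j → A i j * x j)

    rest-scale : ∀ i y b → rest i (λ j → b * y j) ≡ b * rest i y
    rest-scale i y b = begin
      rest i (λ j → b * y j)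
        ≡⟨ sum-cong-≗ (λ j → solve 3 (λ u v w → u :* (v :* w) := v :* (u :* w)) refl (A i (punchIn p j)) b (y j)) ⟩
      sum (λ j → b * (A i (punchIn p j) * y j))
        ≡⟨ *-distribˡ-sum b (λ j → A i (punchIn p j) * y j) ⟨
      b * rest i y ∎

    eliminate-· : ∀ y i → (eliminate · y) i ≡ a * rest (suc i) y + (- A (suc i) p) * rest zero y
    eliminate-· y i = begin
      (eliminate · y) i
        ≡⟨ sum-cong-≗ (λ j → solve 5 (λ u v w z t → (u :* v :+ w :* z) :* t := u :* (v :* t) :+ w :* (z :* t)) refl
             a (A (suc i) (punchIn p j)) (- A (suc i) p) (A zero (punchIn p j)) (y j)) ⟩
      sum (λ j → a * (A (suc i) (punchIn p j) * y j) + (- A (suc i) p) * (A zero (punchIn p j) * y j))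
        ≡⟨ ∑-distrib-+ (λ j → a * (A (suc i) (punchIn p j) * y j)) (λ j → (- A (suc i) p) * (A zero (punchIn p j) * y j)) ⟩
      sum (λ j → a * (A (suc i) (punchIn p j) * y j)) + sum (λ j → (- A (suc i) p) * (A zero (punchIn p j) * y j))
        ≡⟨ cong₂ _+_ (*-distribˡ-sum a (λ j → A (suc i) (punchIn p j) * y j))
                     (*-distribˡ-sum (- A (suc i) p) (λ j → A zero (punchIn p j) * y j)) ⟨
      a * rest (suc i) y + (- A (suc i) p) * rest zero y ∎

    module _ (a≢0 : a ≢ 0ℚ) where

      eliminate⁺ : IndependentColumns A → IndependentColumns eliminate
      eliminate⁺ ind y By≡0 j = *-cancel-0 a (y j) a≢0 (begin
        a * y j          ≡⟨ insertAt-punchIn (λ l → a * y l) p (- rest zero y) j ⟨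
        x (punchIn p j)  ≡⟨ ind x Ax≡0 (punchIn p j) ⟩
        0ℚ               ∎)
        where
        x : Fin (ℕ.suc n) → ℚ
        x = insertAt (λ l → a * y l) p (- rest zero y)

        Ax : ∀ i → (A · x) i ≡ A i p * (- rest zero y) + a * rest i y
        Ax i = begin
          (A · x) i                               ≡⟨ split x i ⟩
          A i p * x p + rest i (x ∘ punchIn p)    ≡⟨ cong₂ (λ u v → A i p * u + v)
                                                      (insertAt-lookup (λ l → a * y l) p (- rest zero y))
                                                      (sum-cong-≗ (λ l → cong (A i (punchIn p l) *_)
                                                        (insertAt-punchIn (λ l → a * y l) p (- rest zero y) l))) ⟩
          A i p * (- rest zero y) + rest i (λ l → a * y l)
                                                  ≡⟨ cong (A i p * (- rest zero y) +_) (rest-scale i y a) ⟩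
          A i p * (- rest zero y) + a * rest i y  ∎

        Ax≡0 : ∀ i → (A · x) i ≡ 0ℚ
        Ax≡0 zero    = trans (Ax zero) (solve 2 (λ u v → u :* (:- v) :+ u :* v := con 0ℚ) refl a (rest zero y))
        Ax≡0 (suc i) = begin
          (A · x) (suc i)
            ≡⟨ Ax (suc i) ⟩
          A (suc i) p * (- rest zero y) + a * rest (suc i) y
            ≡⟨ solve 4 (λ u v w z → u :* (:- v) :+ w :* z := w :* z :+ (:- u) :* v) refl
                 (A (suc i) p) (rest zero y) a (rest (suc i) y) ⟩
          a * rest (suc i) y + (- A (suc i) p) * rest zero y
            ≡⟨ eliminate-· y i ⟨
          (eliminate · y) i
            ≡⟨ By≡0 i ⟩
          0ℚ ∎

      module _ (ind : IndependentColumns eliminate) (x : Fin (ℕ.suc n) → ℚ) (Ax≡0 : ∀ i → (A · x) i ≡ 0ℚ) where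

        rest≡0 : ∀ j → x (punchIn p j) ≡ 0ℚ
        rest≡0 = ind y λ i → begin
          (eliminate · y) i
            ≡⟨ eliminate-· y i ⟩
          a * rest (suc i) y + (- A (suc i) p) * rest zero y
            ≡⟨ solve 5 (λ u v w z t → u :* v :+ (:- w) :* z := u :* (w :* t :+ v) :- w :* (u :* t :+ z)) refl
                 a (rest (suc i) y) (A (suc i) p) (rest zero y) (x p) ⟩
          a * (A (suc i) p * x p + rest (suc i) y) - A (suc i) p * (a * x p + rest zero y)
            ≡⟨ cong₂ (λ u v → a * u - A (suc i) p * v)
                 (trans (sym (split x (suc i))) (Ax≡0 (suc i)))
                 (trans (sym (split x zero)) (Ax≡0 zero)) ⟩
          a * 0ℚ - A (suc i) p * 0ℚ
            ≡⟨ solve 2 (λ u v → u :* con 0ℚ :- v :* con 0ℚ := con 0ℚ) refl a (A (suc i) p) ⟩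
          0ℚ ∎
          where
          y : Fin n → ℚ
          y = x ∘ punchIn p

        pivot≡0 : x p ≡ 0ℚ
        pivot≡0 = *-cancel-0 a (x p) a≢0 (begin
          a * x p                              ≡⟨ +-identityʳ (a * x p) ⟨
          a * x p + 0ℚ                         ≡⟨ cong (a * x p +_) (sum-zero _ λ j →
                                                    trans (cong (A zero (punchIn p j) *_) (rest≡0 j)) (*-zeroʳ (A zero (punchIn p j)))) ⟨
          a * x p + rest zero (x ∘ punchIn p)  ≡⟨ split x zero ⟨
          (A · x) zero                         ≡⟨ Ax≡0 zero ⟩
          0ℚ                                   ∎)

        eliminate⁻ : ∀ j → x j ≡ 0ℚ
        eliminate⁻ j with p Fin.≟ j
        ... | yes p≡j = subst (λ l → x l ≡ 0ℚ) p≡j pivot≡0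
        ... | no  p≢j = subst (λ l → x l ≡ 0ℚ) (punchIn-punchOut p≢j) (rest≡0 (punchOut p≢j))

  zeroRow : ∀ {m n} (A : Matrix (ℕ.suc m) n) → ¬ (∃ λ p → A zero p ≢ 0ℚ) → ∀ j → A zero j ≡ 0ℚ
  zeroRow A ∄p j = decidable-stable (A zero j ≟ 0ℚ) (λ A₀ⱼ≢0 → ∄p (j , A₀ⱼ≢0))

independent? : ∀ {m n} (A : Matrix m n) → Dec (IndependentColumns A)
independent? {_}       {ℕ.zero}  A = yes λ _ _ ()
independent? {ℕ.zero}  {ℕ.suc n} A = no λ ind → contradiction (ind (λ _ → 1ℚ) (λ ()) zero) λ ()
independent? {ℕ.suc m} {ℕ.suc n} A with any? (λ p → ¬? (A zero p ≟ 0ℚ))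
... | no ∄p         = Dec.map (⇔-sym (dropRow A (zeroRow A ∄p))) (independent? (A ∘ suc))
... | yes (p , a≢0) = Dec.map′ (eliminate⁻ A p a≢0) (eliminate⁺ A p a≢0) (independent? (eliminate A p))

independent⇒≤ : ∀ {m n} (A : Matrix m n) → IndependentColumns A → n ≤ m
independent⇒≤ {_}       {ℕ.zero}  A ind = z≤n
independent⇒≤ {ℕ.zero}  {ℕ.suc n} A ind = contradiction (ind (λ _ → 1ℚ) (λ ()) zero) λ ()
independent⇒≤ {ℕ.suc m} {ℕ.suc n} A ind with any? (λ p → ¬? (A zero p ≟ 0ℚ))
... | no ∄p         = ℕ.m≤n⇒m≤1+n (independent⇒≤ (A ∘ suc) (Equivalence.to (dropRow A (zeroRow A ∄p)) ind))
... | yes (p , a≢0) = s≤s (independent⇒≤ (eliminate A p) (eliminate⁺ A p a≢0 ind))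

private
  HasIndependent : ∀ {m n} → Matrix m n → ℕ → Set
  HasIndependent {n = n} A s = ∃ λ (c : Fin s → Fin n) → IndependentColumns (columns A c)

  hasIndependent? : ∀ {m n} (A : Matrix m n) s → Dec (HasIndependent A s)
  hasIndependent? {n = n} A s = Dec.map′
    (λ (k , ind) → finToFun k , ind)
    (λ (c , ind) → funToFin c , independent-resp (λ i a → cong (A i) (sym (finToFun-funToFin c a))) ind)
    (any? (λ (k : Fin (n ℕ.^ s)) → independent? (columns A (finToFun k))))

  search : ∀ {m n} (A : Matrix m n) b → (∀ {s} → HasIndependent A s → s ≤ b) → ∃ (IsRank A)
  search A b bound with hasIndependent? A b
  ... | yes h = b , h , λ c ind → bound (c , ind)
  search A ℕ.zero    bound | no ¬h = contradiction ((λ ()) , λ _ _ ()) ¬h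
  search A (ℕ.suc b) bound | no ¬h = search A b λ {s} h →
    ℕ.s≤s⁻¹ (ℕ.≤∧≢⇒< (bound h) λ s≡1+b → ¬h (subst (HasIndependent A) s≡1+b h))

rank-exists : ∀ {m n} (A : Matrix m n) → ∃ (IsRank A)
rank-exists {m} A = search A m λ (c , ind) → independent⇒≤ (columns A c) ind

rank : ∀ {m n} → Matrix m n → ℕ
rank A = proj₁ (rank-exists A)

rank-isRank : ∀ {m n} (A : Matrix m n) → IsRank A (rank A)
rank-isRank A = proj₂ (rank-exists A)

record Graph (n : ℕ) : Set₁ where
  field
    Adj       : Fin n → Fin n → Set
    _adj?_    : Decidable Adj
    symmetric : Symmetric Adj
    loopless  : Irreflexive _≡_ Adj

record Orientation {n} (G : Graph n) : Set₁ where
  open Graph G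
  field
    Arc        : Fin n → Fin n → Set
    _arc?_     : Decidable Arc
    arc⇒adj    : ∀ {u v} → Arc u v → Adj u v
    adj⇒arc    : ∀ {u v} → Adj u v → Arc u v ⊎ Arc v u
    asymmetric : Asymmetric Arc

  skewAdjacency : Matrix n n
  skewAdjacency i j =
    if does (i arc? j) then 1ℚ else if does (j arc? i) then - 1ℚ else 0ℚ

  -- The rank over ℚ; it is the same over every field of characteristic zero.
  skewRank : ℕ
  skewRank = rank skewAdjacency

next : ∀ {k} → Fin k → Fin k
next {ℕ.suc k} i = ℕ.suc (toℕ i) mod ℕ.suc k

record Cycle {n} (G : Graph n) (k : ℕ) : Set where
  open Graph G
  field
    length≥3  : 3 ≤ k
    vertex    : Fin k → Fin n
    injective : Injective _≡_ _≡_ vertex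
    adjacent  : ∀ i → Adj (vertex i) (vertex (next i))

  Edge : Fin n → Fin n → Set
  Edge u v = ∃ λ i → (u ≡ vertex i × v ≡ vertex (next i)) ⊎ (v ≡ vertex i × u ≡ vertex (next i))

-- Cycles are counted as subgraphs: parametrisations of one cycle by different
-- starting points or directions have the same edges and are identified.
_≈_ : ∀ {n} {G : Graph n} {k l} → Cycle G k → Cycle G l → Set
C ≈ D = ∀ u v → Cycle.Edge C u v ⇔ Cycle.Edge D u v

record Unicyclic {n} (G : Graph n) : Set where
  open Graph G
  field
    connected : ∀ u v → Star Adj u v
    girth     : ℕ
    cycle     : Cycle G girth
    unique    : ∀ {l} (C : Cycle G l) → C ≈ cycle

-- The cycle C_k with m pendant edges attached at its vertex v; the vertices
-- are those of C_k followed by the m leaves.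
private
  next≢ : ∀ {k} → 2 ≤ k → (i : Fin k) → i ≢ next i
  next≢ {ℕ.suc k} 2≤k i i≡next with ℕ.m≤n⇒m<n∨m≡n (toℕ<n i)
  ... | inj₁ 1+i<1+k = ℕ.1+n≢n (trans (sym (m<n⇒m%n≡m 1+i<1+k)) toℕ-next)
    where
    toℕ-next : ℕ.suc (toℕ i) ℕ.% ℕ.suc k ≡ toℕ i
    toℕ-next = trans (sym (toℕ-fromℕ< (m%n<n (ℕ.suc (toℕ i)) (ℕ.suc k)))) (sym (cong toℕ i≡next))
  ... | inj₂ 1+i≡1+k = ℕ.<⇒≢ 2≤k (trans (cong ℕ.suc (sym i≡0)) 1+i≡1+k)
    where
    i≡0 : toℕ i ≡ 0
    i≡0 = trans (cong toℕ i≡next)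
         (trans (toℕ-fromℕ< (m%n<n (ℕ.suc (toℕ i)) (ℕ.suc k)))
         (trans (cong (ℕ._% ℕ.suc k) 1+i≡1+k) (n%n≡0 (ℕ.suc k))))

module _ {k} (m : ℕ) (v : Fin k) where

  PendantAdj : Fin k ⊎ Fin m → Fin k ⊎ Fin m → Set
  PendantAdj (inj₁ i) (inj₁ j) = j ≡ next i ⊎ i ≡ next j
  PendantAdj (inj₁ i) (inj₂ _) = i ≡ v
  PendantAdj (inj₂ _) (inj₁ j) = j ≡ v
  PendantAdj (inj₂ _) (inj₂ _) = ⊥

  private
    pendantAdj? : Decidable PendantAdj
    pendantAdj? (inj₁ i) (inj₁ j) = (j Fin.≟ next i) ⊎-dec (i Fin.≟ next j)
    pendantAdj? (inj₁ i) (inj₂ _) = i Fin.≟ v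
    pendantAdj? (inj₂ _) (inj₁ j) = j Fin.≟ v
    pendantAdj? (inj₂ _) (inj₂ _) = no λ ()

    pendantAdj-sym : ∀ x y → PendantAdj x y → PendantAdj y x
    pendantAdj-sym (inj₁ _) (inj₁ _) = swap
    pendantAdj-sym (inj₁ _) (inj₂ _) eq = eq
    pendantAdj-sym (inj₂ _) (inj₁ _) eq = eq

    pendantAdj-irrefl : 2 ≤ k → ∀ x → ¬ PendantAdj x x
    pendantAdj-irrefl 2≤k (inj₁ i) = [ next≢ 2≤k i , next≢ 2≤k i ]′
    pendantAdj-irrefl 2≤k (inj₂ _) ()

  cycleWithPendants : 3 ≤ k → Graph (k ℕ.+ m)
  cycleWithPendants 3≤k = record
    { Adj       = λ x y → PendantAdj (splitAt k x) (splitAt k y)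
    ; _adj?_    = λ x y → pendantAdj? (splitAt k x) (splitAt k y)
    ; symmetric = λ {x} {y} → pendantAdj-sym (splitAt k x) (splitAt k y)
    ; loopless  = λ { {x} refl → pendantAdj-irrefl (ℕ.<⇒≤ 3≤k) (splitAt k x) }
    }

{-# OPTIONS --safe #-}

-- Lower bound: as n > k, some vertex u off the cycle is adjacent to a cycle
-- vertex c₀.  The even number N of vertices u, c₀, c₁, … with N = k or N = k + 1
-- carries a single perfect matching, because by unicyclicity the only possible
-- edge besides those of this path closes the odd cycle.  The corresponding
-- columns are independent: in a vector of the kernel the entries at odd positions
-- vanish from the left to the right, then those at even positions backwards.
-- Upper bound: every leaf row is a multiple of the unit row at v, so k + 1 rows
-- span the row space.  When k is even, the rows at odd distance from v along the
-- cycle live on the even positions, and together with the unit row at v they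
-- satisfy one linear relation, so that one of them can be dropped.

module Submission where

open import Defs
open import Algebra.Bundles using (CommutativeRing)
import Algebra.Properties.Semiring.Sum as Sum
open import Data.Bool.Base using (if_then_else_)
open import Data.Fin.Base using (Fin; zero; suc; toℕ; fromℕ; fromℕ<; punchIn; splitAt; join; _↑ˡ_; _↑ʳ_)
import Data.Fin.Base as Fin
open import Data.Fin.Properties as Fin
  using (any?; toℕ-fromℕ; toℕ-fromℕ<; toℕ<n; toℕ≤pred[n]; toℕ-injective; punchInᵢ≢i; injective⇒≤; ¬∀⟶∃¬;
         splitAt-join; join-splitAt; splitAt⁻¹-↑ˡ; ↑ˡ-injective)
open import Data.Nat.Base using (ℕ; zero; suc; _+_; _*_; _∸_; _%_; _≤_; _<_; _≥_; z≤n; s≤s; s≤s⁻¹)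
open import Data.Nat.DivMod using (m<n⇒m%n≡m; n%n≡0; m%n<n)
open import Data.Nat.Divisibility using (_∣_; divides)
open import Data.Nat.GeneralisedArithmetic using (fold)
import Data.Nat.Properties as ℕ
open import Data.Product.Base using (_×_; Σ-syntax; ∃; _,_; proj₁; proj₂)
open import Data.Rational.Base as ℚ using (ℚ; 0ℚ; 1ℚ; 1/_; ≢-nonZero)
import Data.Rational.Properties as ℚ
open import Data.Sum.Base using (_⊎_; inj₁; inj₂; [_,_]′)
open import Function.Base using (_∘_; id)
open import Function.Bundles using (mk⇔; Equivalence)
open import Function.Definitions using (Injective)
open import Relation.Binary.Construct.Closure.ReflexiveTransitive using (Star; ε; _◅_; _◅◅_; reverse)
open import Relation.Binary.Definitions using (tri<; tri≈; tri>)
open import Relation.Binary.PropositionalEquality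
open import Relation.Nullary using (Dec; ¬_; does; yes; no; contradiction)
open import Relation.Nullary.Decidable using (_×-dec_)
open Orientation using (skewRank)
open Unicyclic using (girth)

open Sum (CommutativeRing.semiring ℚ.+-*-commutativeRing)
  using (sum; sum-remove; sum-cong-≗; sum-replicate-zero; ∑-comm; *-distribˡ-sum)

-- Parity of natural numbers

even≢odd : ∀ a b → a * 2 ≢ suc (b * 2)
even≢odd (suc a) (suc b) eq = even≢odd a b (ℕ.suc-injective (ℕ.suc-injective eq))

even⊎odd : ∀ n → ∃ λ s → n ≡ s * 2 ⊎ n ≡ suc (s * 2)
even⊎odd zero = 0 , inj₁ refl
even⊎odd (suc n) with even⊎odd n
... | s , inj₁ eq = s , inj₂ (cong suc eq)
... | s , inj₂ eq = suc s , inj₁ (cong suc eq)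

-- Rotations of Fin k

next-cases : ∀ {k} (i : Fin k) →
             (suc (toℕ i) < k × toℕ (next i) ≡ suc (toℕ i)) ⊎
             (suc (toℕ i) ≡ k × toℕ (next i) ≡ 0)
next-cases {suc k} i with ℕ.m≤n⇒m<n∨m≡n (toℕ<n i)
... | inj₁ lt = inj₁ (lt , trans (toℕ-fromℕ< (m%n<n (suc (toℕ i)) (suc k))) (m<n⇒m%n≡m lt))
... | inj₂ eq = inj₂ (eq , trans (toℕ-fromℕ< (m%n<n (suc (toℕ i)) (suc k)))
                          (trans (cong (_% suc k) eq) (n%n≡0 (suc k))))

next-injective : ∀ {k} → Injective _≡_ _≡_ (next {k})
next-injective {k} {i} {j} eq with next-cases i | next-cases j
... | inj₁ (_ , p) | inj₁ (_ , q) = toℕ-injective (ℕ.suc-injective (trans (sym p) (trans (cong toℕ eq) q)))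
... | inj₂ (p , _) | inj₂ (q , _) = toℕ-injective (ℕ.suc-injective (trans p (sym q)))
... | inj₁ (_ , p) | inj₂ (_ , q) = contradiction (trans (sym p) (trans (cong toℕ eq) q)) λ ()
... | inj₂ (_ , p) | inj₁ (_ , q) = contradiction (trans (sym q) (trans (cong toℕ (sym eq)) p)) λ ()

-- At most `k` rotations wrap around at most once, since a second wrap would need `d + toℕ i` to
-- reach `2k`. The wrapped case is stated additively to avoid truncated subtraction.
toℕ-fold-next : ∀ {k} (i : Fin k) d → d ≤ k →
                toℕ (fold i next d) ≡ d + toℕ i ⊎ toℕ (fold i next d) + k ≡ d + toℕ i
toℕ-fold-next i zero _ = inj₁ refl
toℕ-fold-next {k} i (suc d) d<k
  with toℕ-fold-next i d (ℕ.<⇒≤ d<k) | next-cases (fold i next d)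
... | inj₁ p | inj₁ (_ , q) = inj₁ (trans q (cong suc p))
... | inj₁ p | inj₂ (e , q) = inj₂ (trans (cong (_+ k) q) (trans (sym e) (cong suc p)))
... | inj₂ p | inj₁ (_ , q) = inj₂ (trans (cong (_+ k) q) (cong suc p))
... | inj₂ p | inj₂ (e , q) = contradiction 2k≤ (ℕ.<⇒≱ <2k)
  where
  2k≤ : k + k ≤ suc d + toℕ i
  2k≤ = ℕ.≤-reflexive (trans (cong (_+ k) (sym e)) (cong suc p))
  <2k : suc d + toℕ i < k + k
  <2k = ℕ.+-mono-≤-< d<k (toℕ<n i)

fold-next-period : ∀ {k} (i : Fin k) → fold i next k ≡ i
fold-next-period {k} i with toℕ-fold-next i k ℕ.≤-refl
... | inj₁ p = contradiction (toℕ<n (fold i next k)) (ℕ.≤⇒≯ (subst (k ≤_) (sym p) (ℕ.m≤m+n k (toℕ i))))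
... | inj₂ p = toℕ-injective (ℕ.+-cancelʳ-≡ k _ _ (trans p (ℕ.+-comm k (toℕ i))))

fold-next≢ : ∀ {k} (i : Fin k) d → 0 < d → d < k → fold i next d ≢ i
fold-next≢ {k} i d 0<d d<k eq with toℕ-fold-next i d (ℕ.<⇒≤ d<k)
... | inj₁ p = ℕ.<⇒≢ 0<d (ℕ.+-cancelʳ-≡ (toℕ i) 0 d (trans (cong toℕ (sym eq)) p))
... | inj₂ p = ℕ.<⇒≢ d<k (ℕ.+-cancelʳ-≡ (toℕ i) d k
                 (trans (sym p) (trans (cong ((_+ k) ∘ toℕ) eq) (ℕ.+-comm (toℕ i) k))))

fold-next-comm : ∀ {k} (i : Fin k) d → fold (next i) next d ≡ next (fold i next d)
fold-next-comm i zero    = refl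
fold-next-comm i (suc d) = cong next (fold-next-comm i d)

fold-next-injectiveˡ : ∀ {k} d {i j : Fin k} → fold i next d ≡ fold j next d → i ≡ j
fold-next-injectiveˡ zero    eq = eq
fold-next-injectiveˡ (suc d) eq = fold-next-injectiveˡ d (next-injective eq)

fold-next-injectiveʳ : ∀ {k} (i : Fin k) {a b} → a < k → b < k →
                       fold i next a ≡ fold i next b → a ≡ b
fold-next-injectiveʳ {k} i {zero}  {zero}  _ _ _ = refl
fold-next-injectiveʳ {k} i {zero}  {suc b} _ b<k eq = contradiction (sym eq) (fold-next≢ i (suc b) (s≤s z≤n) b<k)
fold-next-injectiveʳ {k} i {suc a} {zero}  a<k _ eq = contradiction eq (fold-next≢ i (suc a) (s≤s z≤n) a<k)
fold-next-injectiveʳ {k} i {suc a} {suc b} a<k b<k eq =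
  cong suc (fold-next-injectiveʳ i (ℕ.<⇒≤ a<k) (ℕ.<⇒≤ b<k) (next-injective eq))

-- The number of steps is `j - i`, increased by `k` if negative. The other alternative of
-- `toℕ-fold-next` would put a value outside the range below `k`.
fold-next-reaches : ∀ {k} (i j : Fin k) → ∃ λ d → d < k × fold i next d ≡ j
fold-next-reaches {k} i j with toℕ i ℕ.≤? toℕ j
... | yes i≤j = d , d<k , lemma
  where
  d : ℕ
  d = toℕ j ∸ toℕ i
  d<k : d < k
  d<k = ℕ.≤-<-trans (ℕ.m∸n≤m (toℕ j) (toℕ i)) (toℕ<n j)
  lemma : fold i next d ≡ j
  lemma with toℕ-fold-next i d (ℕ.<⇒≤ d<k)
  ... | inj₁ p = toℕ-injective (trans p (ℕ.m∸n+n≡m i≤j))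
  ... | inj₂ p = contradiction (toℕ<n j)
                   (ℕ.≤⇒≯ (subst (k ≤_) (trans p (ℕ.m∸n+n≡m i≤j)) (ℕ.m≤n+m k _)))
... | no i≰j = d , d<k , lemma
  where
  i≤j+k : toℕ i ≤ toℕ j + k
  i≤j+k = ℕ.≤-trans (ℕ.<⇒≤ (toℕ<n i)) (ℕ.m≤n+m k (toℕ j))
  d : ℕ
  d = toℕ j + k ∸ toℕ i
  d<k : d < k
  d<k = ℕ.+-cancelʳ-< (toℕ i) d k (subst₂ _<_ (sym (ℕ.m∸n+n≡m i≤j+k)) (ℕ.+-comm (toℕ i) k)
          (ℕ.+-monoˡ-< k (ℕ.≰⇒> i≰j)))
  lemma : fold i next d ≡ j
  lemma with toℕ-fold-next i d (ℕ.<⇒≤ d<k)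
  ... | inj₁ p = contradiction (toℕ<n (fold i next d))
                   (ℕ.≤⇒≯ (subst (k ≤_) (sym (trans p (ℕ.m∸n+n≡m i≤j+k))) (ℕ.m≤n+m k (toℕ j))))
  ... | inj₂ p = toℕ-injective (ℕ.+-cancelʳ-≡ k _ _ (trans p (ℕ.m∸n+n≡m i≤j+k)))

-- Rank and kernels

x*y≡0⇒y≡0 : ∀ x y → x ≢ 0ℚ → x ℚ.* y ≡ 0ℚ → y ≡ 0ℚ
x*y≡0⇒y≡0 x y x≢0 xy≡0 = begin
  y                      ≡⟨ ℚ.*-identityˡ y ⟨
  1ℚ ℚ.* y               ≡⟨ cong (ℚ._* y) (ℚ.*-inverseˡ x) ⟨
  (1/ x ℚ.* x) ℚ.* y     ≡⟨ ℚ.*-assoc (1/ x) x y ⟩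
  1/ x ℚ.* (x ℚ.* y)     ≡⟨ cong (1/ x ℚ.*_) xy≡0 ⟩
  1/ x ℚ.* 0ℚ            ≡⟨ ℚ.*-zeroʳ (1/ x) ⟩
  0ℚ                     ∎
  where
  open ≡-Reasoning
  instance _ = ≢-nonZero x≢0

sum-zeros : ∀ {n} (f : Fin n → ℚ) → (∀ j → f j ≡ 0ℚ) → sum f ≡ 0ℚ
sum-zeros {n} f f≡0 = trans (sum-cong-≗ f≡0) (sum-replicate-zero n)

sum-single : ∀ {n} (f : Fin n → ℚ) i → (∀ j → j ≢ i → f j ≡ 0ℚ) → sum f ≡ f i
sum-single {suc n} f i f≡0 = begin
  sum f                                ≡⟨ sum-remove {i = i} f ⟩
  f i ℚ.+ sum (f ∘ punchIn i)          ≡⟨ cong (f i ℚ.+_) (sum-zeros _ λ j → f≡0 _ (punchInᵢ≢i i j)) ⟩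
  f i ℚ.+ 0ℚ                           ≡⟨ ℚ.+-identityʳ (f i) ⟩
  f i                                  ∎
  where open ≡-Reasoning

rank-≥ : ∀ {m n s} (A : Matrix m n) (c : Fin s → Fin n) → IndependentColumns (columns A c) → rank A ≥ s
rank-≥ A c ind = proj₂ (rank-isRank A) c ind

-- Summing over all `j` collects the coefficients of a column that `c` selects several times.
pushforward : ∀ {n s} → (Fin s → Fin n) → (Fin s → ℚ) → (Fin n → ℚ)
pushforward c x w = sum λ j → if does (c j Fin.≟ w) then x j else 0ℚ

·-pushforward : ∀ {m n s} (A : Matrix m n) (c : Fin s → Fin n) x i →
                (A · pushforward c x) i ≡ (columns A c · x) i
·-pushforward A c x i = begin
  sum (λ w → A i w ℚ.* sum (λ j → δ j w))     ≡⟨ sum-cong-≗ (λ w → *-distribˡ-sum (A i w) (λ j → δ j w)) ⟩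
  sum (λ w → sum (λ j → A i w ℚ.* δ j w))     ≡⟨ ∑-comm (λ w j → A i w ℚ.* δ j w) ⟩
  sum (λ j → sum (λ w → A i w ℚ.* δ j w))     ≡⟨ sum-cong-≗ (λ j → trans (sum-single _ (c j) (off j)) (on j)) ⟩
  sum (λ j → A i (c j) ℚ.* x j)               ∎
  where
  open ≡-Reasoning
  δ : Fin _ → Fin _ → ℚ
  δ j w = if does (c j Fin.≟ w) then x j else 0ℚ
  off : ∀ j w → w ≢ c j → A i w ℚ.* δ j w ≡ 0ℚ
  off j w w≢cj with c j Fin.≟ w
  ... | yes eq = contradiction (sym eq) w≢cj
  ... | no _   = ℚ.*-zeroʳ (A i w)
  on : ∀ j → A i (c j) ℚ.* δ j (c j) ≡ A i (c j) ℚ.* x j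
  on j with c j Fin.≟ c j
  ... | yes _ = refl
  ... | no ne = contradiction refl ne

-- The hypothesis is the dual form of the rows `ρ` spanning the row space. Independent columns then
-- stay independent when restricted to these `r` rows, so there are at most `r` of them.
rank-≤ : ∀ {m n r} (A : Matrix m n) (ρ : Fin r → Fin m) →
         (∀ y → (∀ b → (A · y) (ρ b) ≡ 0ℚ) → ∀ i → (A · y) i ≡ 0ℚ) → rank A ≤ r
rank-≤ A ρ spans with rank-isRank A
... | (c , ind) , _ = independent⇒≤ (columns (A ∘ ρ) c) λ x Bx≡0 → ind x λ i →
  trans (sym (·-pushforward A c x i))
        (spans (pushforward c x) (λ b → trans (·-pushforward A c x (ρ b)) (Bx≡0 b)) i)

-- Rows of the skew-adjacency matrix and columns along a path

module _ {n} {G : Graph n} (σ : Orientation G) where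
  open Graph G
  open Orientation σ hiding (skewRank)

  skewAdjacency-nonadjacent : ∀ {i j} → ¬ Adj i j → skewAdjacency i j ≡ 0ℚ
  skewAdjacency-nonadjacent {i} {j} ¬ij with i arc? j | j arc? i
  ... | yes a | _     = contradiction (arc⇒adj a) ¬ij
  ... | no _  | yes a = contradiction (symmetric (arc⇒adj a)) ¬ij
  ... | no _  | no _  = refl

  skewAdjacency-adjacent : ∀ {i j} → Adj i j → skewAdjacency i j ≢ 0ℚ
  skewAdjacency-adjacent {i} {j} ij with i arc? j | j arc? i
  ... | yes _ | _     = λ ()
  ... | no _  | yes _ = λ ()
  ... | no ¬a | no ¬b = λ _ → [ ¬a , ¬b ]′ (adj⇒arc ij)

  row-vanishes : ∀ {s} (c : Fin s → Fin n) x u → (∀ j → Adj u (c j) → x j ≡ 0ℚ) →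
                 (columns skewAdjacency c · x) u ≡ 0ℚ
  row-vanishes c x u x≡0 = sum-zeros _ term
    where
    term : ∀ j → skewAdjacency u (c j) ℚ.* x j ≡ 0ℚ
    term j with u adj? c j
    ... | yes a = trans (cong (skewAdjacency u (c j) ℚ.*_) (x≡0 j a)) (ℚ.*-zeroʳ (skewAdjacency u (c j)))
    ... | no ¬a = trans (cong (ℚ._* x j) (skewAdjacency-nonadjacent ¬a)) (ℚ.*-zeroˡ (x j))

  -- Only the term at `i` survives in the row of `u`, and its coefficient is nonzero.
  row-isolates : ∀ {s} (c : Fin s → Fin n) x u i → (columns skewAdjacency c · x) u ≡ 0ℚ → Adj u (c i) →
                 (∀ j → j ≢ i → Adj u (c j) → x j ≡ 0ℚ) → x i ≡ 0ℚ
  row-isolates c x u i row≡0 ui x≡0 =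
    x*y≡0⇒y≡0 _ (x i) (skewAdjacency-adjacent ui) (trans (sym (sum-single _ i term)) row≡0)
    where
    term : ∀ j → j ≢ i → skewAdjacency u (c j) ℚ.* x j ≡ 0ℚ
    term j j≢i with u adj? c j
    ... | yes a = trans (cong (skewAdjacency u (c j) ℚ.*_) (x≡0 j j≢i a)) (ℚ.*-zeroʳ (skewAdjacency u (c j)))
    ... | no ¬a = trans (cong (ℚ._* x j) (skewAdjacency-nonadjacent ¬a)) (ℚ.*-zeroˡ (x j))

  -- The third alternative of `edges` admits the closing edge of an odd cycle: its ends lie at odd
  -- positions, so the rows at even positions do not see it.
  module _ (p : ℕ → Fin n) (t : ℕ)
    (path  : ∀ {a} → suc a < suc t * 2 → Adj (p a) (p (suc a)))
    (edges : ∀ {a b} → a < suc t * 2 → b < suc t * 2 → Adj (p a) (p b) →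
             b ≡ suc a ⊎ a ≡ suc b ⊎ (∃ λ r → a ≡ suc (r * 2)) × (∃ λ r → b ≡ suc (r * 2)))
    where

    pathColumns : Fin (suc t * 2) → Fin n
    pathColumns j = p (toℕ j)

    module _ (x : Fin (suc t * 2) → ℚ)
             (Ax≡0 : ∀ u → (columns skewAdjacency pathColumns · x) u ≡ 0ℚ) where

      -- The row at position `2s` meets only positions `2s - 1` and `2s + 1`, and the former entry
      -- vanishes by induction.
      odd-vanish : ∀ s j → toℕ j ≡ suc (s * 2) → x j ≡ 0ℚ
      odd-vanish s j j≡ = row-isolates pathColumns x (p (s * 2)) j (Ax≡0 _)
        (subst (λ b → Adj (p (s * 2)) (p b)) (sym j≡) (path s<)) other
        where
        s< : suc (s * 2) < suc t * 2
        s< = subst (_< suc t * 2) j≡ (toℕ<n j)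
        other : ∀ i → i ≢ j → Adj (p (s * 2)) (pathColumns i) → x i ≡ 0ℚ
        other i i≢j adj with edges (ℕ.<⇒≤ s<) (toℕ<n i) adj
        ... | inj₁ i≡ = contradiction (toℕ-injective (trans i≡ (sym j≡))) i≢j
        ... | inj₂ (inj₂ ((r , eq) , _)) = contradiction eq (even≢odd s r)
        other i i≢j adj | inj₂ (inj₁ eq) = previous s j≡ eq
          where
          previous : ∀ s → toℕ j ≡ suc (s * 2) → s * 2 ≡ suc (toℕ i) → x i ≡ 0ℚ
          previous (suc s) _ eq = odd-vanish s i (sym (ℕ.suc-injective eq))

      -- The row at position `2s + 1` meets `2s`, `2s + 2` and odd positions, whose entries already
      -- vanish. The induction runs from the right end, with `d` counting the even positions still
      -- to the right.
      even-vanish : ∀ d s j → s + d ≡ t → toℕ j ≡ s * 2 → x j ≡ 0ℚ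
      even-vanish d s j s+d≡t j≡ = row-isolates pathColumns x (p (suc (s * 2))) j (Ax≡0 _)
        (subst (λ b → Adj (p (suc (s * 2))) (p b)) (sym j≡) (symmetric (path s<))) (other d s+d≡t)
        where
        s< : suc (s * 2) < suc t * 2
        s< = s≤s (s≤s (ℕ.*-monoˡ-≤ 2 (subst (s ≤_) s+d≡t (ℕ.m≤m+n s d))))
        other : ∀ d → s + d ≡ t → ∀ i → i ≢ j → Adj (p (suc (s * 2))) (pathColumns i) → x i ≡ 0ℚ
        other d s+d≡t i i≢j adj with edges s< (toℕ<n i) adj
        ... | inj₂ (inj₁ eq) = contradiction (toℕ-injective (trans (sym (ℕ.suc-injective eq)) (sym j≡))) i≢j
        ... | inj₂ (inj₂ (_ , r , eq)) = odd-vanish r i eq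
        -- Here `s = t`, and `2s + 2` lies beyond the end of the path.
        other zero s+0≡t i i≢j adj | inj₁ i≡ =
          contradiction (trans i≡ (cong (λ s → suc s * 2) (trans (sym (ℕ.+-identityʳ s)) s+0≡t))) (ℕ.<⇒≢ (toℕ<n i))
        other (suc d) s+d≡t i i≢j adj | inj₁ i≡ = even-vanish d (suc s) i (trans (sym (ℕ.+-suc s d)) s+d≡t) i≡

    pathColumns-independent : IndependentColumns (columns skewAdjacency pathColumns)
    pathColumns-independent x Ax≡0 j with even⊎odd (toℕ j)
    ... | s , inj₂ j≡ = odd-vanish x Ax≡0 s j j≡
    ... | s , inj₁ j≡ = even-vanish x Ax≡0 (t ∸ s) s j (ℕ.m+[n∸m]≡n s≤t) j≡
      where
      s≤t : s ≤ t
      s≤t = s≤s⁻¹ (ℕ.*-cancelʳ-< 2 s (suc t) (subst (_< suc t * 2) j≡ (toℕ<n j)))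

    skewRank-≥-path : skewRank σ ≥ suc t * 2
    skewRank-≥-path = rank-≥ skewAdjacency pathColumns pathColumns-independent

-- The lower bound

-- If every vertex were hit, choosing preimages would inject `Fin n` into `Fin k`.
uncovered : ∀ {k n} (f : Fin k → Fin n) → k < n → ∃ λ u → ¬ ∃ λ i → f i ≡ u
uncovered {k} {n} f k<n = ¬∀⟶∃¬ n (λ u → ∃ λ i → f i ≡ u) (λ u → any? λ i → f i Fin.≟ u) λ covered →
  ℕ.<⇒≱ k<n (injective⇒≤ {f = proj₁ ∘ covered} λ {u} {v} eq →
    trans (sym (proj₂ (covered u))) (trans (cong f eq) (proj₂ (covered v))))

module _ {n} {G : Graph n} where
  open Graph G

  edge-crossing : ∀ {P : Fin n → Set} → (∀ x → Dec (P x)) → ∀ {x y} → Star Adj x y → P x → ¬ P y →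
                  ∃ λ a → ∃ λ b → Adj a b × P a × ¬ P b
  edge-crossing P? ε px ¬py = contradiction px ¬py
  edge-crossing P? (_◅_ {j = z} xz zy) px ¬py with P? z
  ... | yes pz = edge-crossing P? zy pz ¬py
  ... | no ¬pz = _ , z , xz , px , ¬pz

  module LowerBound (U : Unicyclic G) (u : Fin n) (start : Fin (girth U))
    (off : ∀ i → Cycle.vertex (Unicyclic.cycle U) i ≢ u)
    (attached : Adj u (Cycle.vertex (Unicyclic.cycle U) start)) where
    open Unicyclic U using (cycle; unique) renaming (girth to k)
    open Cycle cycle

    -- Positions `1` to `k` run once around the cycle, so its closing edge joins positions `1` and
    -- `k`. Later positions repeat earlier ones.
    p : ℕ → Fin n
    p zero    = u
    p (suc j) = vertex (fold start next j)

    p-adjacent : ∀ a → Adj (p a) (p (suc a))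
    p-adjacent zero    = attached
    p-adjacent (suc a) = adjacent (fold start next a)

    p-injective : ∀ {a b} → a ≤ k → b ≤ k → p a ≡ p b → a ≡ b
    p-injective {zero}  {zero}  _ _ _  = refl
    p-injective {zero}  {suc b} _ _ eq = contradiction (sym eq) (off _)
    p-injective {suc a} {zero}  _ _ eq = contradiction eq (off _)
    p-injective {suc a} {suc b} a<k b<k eq = cong suc (fold-next-injectiveʳ start a<k b<k (injective eq))

    chord-cycle : ∀ a e → 2 ≤ e → a + e ≤ k → Adj (p a) (p (a + e)) → Cycle G (suc e)
    chord-cycle a e 2≤e a+e≤k adj = record
      { length≥3  = s≤s 2≤e
      ; vertex    = λ i → p (a + toℕ i)
      ; injective = λ {i} {j} eq → toℕ-injective (ℕ.+-cancelˡ-≡ a _ _ (p-injective (bound i) (bound j) eq))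
      ; adjacent  = step
      }
      where
      bound : ∀ (i : Fin (suc e)) → a + toℕ i ≤ k
      bound i = ℕ.≤-trans (ℕ.+-monoʳ-≤ a (toℕ≤pred[n] i)) a+e≤k
      step : ∀ (i : Fin (suc e)) → Adj (p (a + toℕ i)) (p (a + toℕ (next i)))
      step i with next-cases i
      ... | inj₁ (_ , eq) = subst (λ b → Adj (p (a + toℕ i)) (p b))
              (sym (trans (cong (a +_) eq) (ℕ.+-suc a (toℕ i)))) (p-adjacent (a + toℕ i))
      ... | inj₂ (i≡e , eq) = subst₂ (λ b c → Adj (p b) (p c))
              (cong (a +_) (sym (ℕ.suc-injective i≡e)))
              (sym (trans (cong (a +_) eq) (ℕ.+-identityʳ a))) (symmetric adj)

    chord-edge : ∀ a e (2≤e : 2 ≤ e) (a+e≤k : a + e ≤ k) (adj : Adj (p a) (p (a + e))) →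
                 Cycle.Edge (chord-cycle a e 2≤e a+e≤k adj) (p a) (p (a + e))
    -- The chord is the closing edge, from the last index `e` back to index `0`.
    chord-edge a e _ _ _ = fromℕ e , inj₂
      ( cong (λ b → p (a + b)) (sym (toℕ-fromℕ e))
      , cong p (sym (trans (cong (a +_) next≡0) (ℕ.+-identityʳ a))) )
      where
      next≡0 : toℕ (next (fromℕ e)) ≡ 0
      next≡0 with next-cases (fromℕ e)
      ... | inj₁ (lt , _) = contradiction lt (ℕ.<-irrefl (cong suc (toℕ-fromℕ e)))
      ... | inj₂ (_ , eq) = eq

    -- The chord closes a stretch of `p` to a cycle. By uniqueness this cycle has the edges of
    -- `cycle`, so the chord joins consecutive vertices of `cycle`; as `u` is off the cycle, `a`
    -- cannot be `0`.
    chord : ∀ a e → 2 ≤ e → a + e ≤ k → Adj (p a) (p (a + e)) → a ≡ 1 × a + e ≡ k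
    chord a e 2≤e a+e≤k adj with Equivalence.to (unique (chord-cycle a e 2≤e a+e≤k adj) (p a) (p (a + e)))
                                   (chord-edge a e 2≤e a+e≤k adj)
    chord zero e _ _ _ | i , inj₁ (eq , _) = contradiction (sym eq) (off i)
    chord zero e _ _ _ | i , inj₂ (_ , eq) = contradiction (sym eq) (off (next i))
    -- Traversed forwards, the edge would have `e = 1`.
    chord (suc a) e 2≤e a+e<k adj | i , inj₁ (pa , pb) =
      contradiction (ℕ.+-cancelˡ-≡ (suc a) e 1 (trans b≡ (sym (ℕ.+-comm (suc a) 1)))) (ℕ.<⇒≢ 2≤e ∘ sym)
      where
      b≡ : suc a + e ≡ suc (suc a)
      b≡ = p-injective a+e<k
        (ℕ.≤-trans (subst (_≤ suc a + e) (ℕ.+-comm (suc a) 1) (ℕ.+-monoʳ-≤ (suc a) (ℕ.<⇒≤ 2≤e))) a+e<k)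
        (trans pb (cong (vertex ∘ next) (sym (injective pa))))
    chord (suc a) e 2≤e a+e<k adj | i , inj₂ (pb , pa) with ℕ.m≤n⇒m<n∨m≡n a+e<k
    -- Before position `k` the successor on the cycle is the next position, which cannot be the
    -- earlier end of the chord.
    ... | inj₁ lt = contradiction
            (p-injective (ℕ.≤-trans (ℕ.m≤m+n (suc a) e) a+e<k) lt (trans pa (cong (vertex ∘ next) (sym (injective pb)))))
            (ℕ.<⇒≢ (s≤s (ℕ.m≤m+n (suc a) e)))
    ... | inj₂ b≡k = p-injective (ℕ.≤-trans (ℕ.m≤m+n (suc a) e) a+e<k) (ℕ.<⇒≤ (ℕ.<⇒≤ length≥3)) (begin
            p (suc a)                            ≡⟨ pa ⟩
            vertex (next i)                      ≡⟨ cong (vertex ∘ next) (injective pb) ⟨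
            vertex (fold start next (suc a + e)) ≡⟨ cong (vertex ∘ fold start next) b≡k ⟩
            vertex (fold start next k)           ≡⟨ cong vertex (fold-next-period start) ⟩
            p 1                                  ∎) , b≡k
      where open ≡-Reasoning

    forward-edge : ∀ {a b} → a < b → b ≤ k → Adj (p a) (p b) → b ≡ suc a ⊎ (a ≡ 1 × b ≡ k)
    forward-edge {a} {b} a<b b≤k adj with ℕ.m≤n⇒m<n∨m≡n a<b
    ... | inj₂ eq = inj₁ (sym eq)
    ... | inj₁ lt = inj₂ (subst (λ c → a ≡ 1 × c ≡ k) a+e≡b
            (chord a (b ∸ a) 2≤e (subst (_≤ k) (sym a+e≡b) b≤k) (subst (Adj (p a) ∘ p) (sym a+e≡b) adj)))
      where
      a+e≡b : a + (b ∸ a) ≡ b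
      a+e≡b = ℕ.m+[n∸m]≡n (ℕ.<⇒≤ a<b)
      2≤e : 2 ≤ b ∸ a
      2≤e = ℕ.m+n≤o⇒m≤o∸n 2 lt

    -- The closing edge joins positions `1` and `k`. Position `k` is among those used only if
    -- `k < suc t * 2`, and then both ends must be odd.
    skewRank-≥ : ∀ (σ : Orientation G) t → suc t * 2 ≤ suc k → (k < suc t * 2 → ∃ λ r → k ≡ suc (r * 2)) →
                 skewRank σ ≥ suc t * 2
    skewRank-≥ σ t N≤ k-odd = skewRank-≥-path σ p t (λ {a} _ → p-adjacent a) edges
      where
      edges : ∀ {a b} → a < suc t * 2 → b < suc t * 2 → Adj (p a) (p b) →
              b ≡ suc a ⊎ a ≡ suc b ⊎ (∃ λ r → a ≡ suc (r * 2)) × (∃ λ r → b ≡ suc (r * 2))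
      edges {a} {b} a< b< adj with ℕ.<-cmp a b
      ... | tri≈ _ a≡b _ = contradiction adj (loopless (cong p a≡b))
      ... | tri< a<b _ _ with forward-edge a<b (s≤s⁻¹ (ℕ.≤-trans b< N≤)) adj
      ...   | inj₁ eq = inj₁ eq
      ...   | inj₂ (a≡1 , refl) = inj₂ (inj₂ ((0 , a≡1) , k-odd b<))
      edges {a} {b} a< b< adj | tri> _ _ b<a with forward-edge b<a (s≤s⁻¹ (ℕ.≤-trans a< N≤)) (symmetric adj)
      ...   | inj₁ eq = inj₂ (inj₁ eq)
      ...   | inj₂ (b≡1 , refl) = inj₂ (inj₂ (k-odd a< , (0 , b≡1)))

skewRank-≥-girth : ∀ {n} (G : Graph n) (σ : Orientation G) (U : Unicyclic G) → girth U < n →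
                   (2 ∣ girth U → skewRank σ ≥ girth U) × (¬ 2 ∣ girth U → skewRank σ ≥ suc (girth U))
skewRank-≥-girth G σ U k<n = even , odd
  where
  open Graph G
  open Unicyclic U using (connected; cycle) renaming (girth to k)
  open Cycle cycle

  onCycle? : ∀ x → Dec (∃ λ i → vertex i ≡ x)
  onCycle? x = any? λ i → vertex i Fin.≟ x

  0<k : 0 < k
  0<k = ℕ.<⇒≤ (ℕ.<⇒≤ length≥3)

  crossing : ∃ λ a → ∃ λ b → Adj a b × (∃ λ i → vertex i ≡ a) × ¬ ∃ λ i → vertex i ≡ b
  crossing = let w , w-off = uncovered vertex k<n in
    edge-crossing {G = G} onCycle? (connected (vertex (fromℕ< 0<k)) w) (_ , refl) w-off

  bound : ∀ t → suc t * 2 ≤ suc k → (k < suc t * 2 → ∃ λ r → k ≡ suc (r * 2)) → skewRank σ ≥ suc t * 2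
  bound with crossing
  ... | _ , u , adj , (i , refl) , u-off =
    LowerBound.skewRank-≥ U u i (λ j eq → u-off (j , eq)) (symmetric adj) σ

  even : 2 ∣ k → skewRank σ ≥ k
  even (divides zero eq) = contradiction (sym eq) (ℕ.<⇒≢ 0<k)
  even (divides (suc t) eq) = subst (skewRank σ ≥_) (sym eq)
    -- With `k` vertices the path stops at position `k - 1`, which leaves the closing edge out.
    (bound t (ℕ.m≤n⇒m≤1+n (ℕ.≤-reflexive (sym eq))) λ k<N → contradiction eq (ℕ.<⇒≢ k<N))

  odd : ¬ 2 ∣ k → skewRank σ ≥ suc k
  odd ¬2∣k with even⊎odd k
  ... | s , inj₁ eq = contradiction (divides s eq) ¬2∣k
  ... | s , inj₂ eq = subst (λ k → skewRank σ ≥ suc k) (sym eq)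
    (bound s (ℕ.≤-reflexive (cong suc (sym eq))) λ _ → s , eq)

-- The cycle with pendant edges

-- A witness that the statement about all orientations of the extremal graph is not vacuous.
natural-orientation : ∀ {n} (G : Graph n) → Orientation G
natural-orientation G = record
  { Arc        = λ u v → Adj u v × u Fin.< v
  ; _arc?_     = λ u v → (u adj? v) ×-dec (u Fin.<? v)
  ; arc⇒adj    = proj₁
  ; adj⇒arc    = orient
  ; asymmetric = λ (_ , u<v) (_ , v<u) → ℕ.<-asym u<v v<u
  }
  where
  open Graph G
  orient : ∀ {u v} → Adj u v → (Adj u v × u Fin.< v) ⊎ (Adj v u × v Fin.< u)
  orient {u} {v} adj with Fin.<-cmp u v
  ... | tri< u<v _ _ = inj₁ (adj , u<v)
  ... | tri≈ _ u≡v _ = contradiction adj (loopless u≡v)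
  ... | tri> _ _ v<u = inj₂ (symmetric adj , v<u)

module Pendants {k} (m : ℕ) (v : Fin k) (3≤k : 3 ≤ k) where

  H : Graph (k + m)
  H = cycleWithPendants m v 3≤k
  open Graph H

  ι : Fin k → Fin (k + m)
  ι = _↑ˡ m

  adj-join : ∀ s t → PendantAdj m v s t → Adj (join k m s) (join k m t)
  adj-join s t = subst₂ (PendantAdj m v) (sym (splitAt-join k m s)) (sym (splitAt-join k m t))

  join-adj : ∀ s t → Adj (join k m s) (join k m t) → PendantAdj m v s t
  join-adj s t = subst₂ (PendantAdj m v) (splitAt-join k m s) (splitAt-join k m t)

  join-elim : ∀ {P : Fin (k + m) → Set} → (∀ s → P (join k m s)) → ∀ x → P x
  join-elim {P} f x = subst P (join-splitAt k m x) (f (splitAt k x))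

  around : Cycle H k
  around = record
    { length≥3  = 3≤k
    ; vertex    = ι
    ; injective = λ {i} {j} → ↑ˡ-injective m i j
    ; adjacent  = λ i → adj-join (inj₁ i) (inj₁ (next i)) (inj₁ refl)
    }

  from-v : ∀ d → Star Adj (ι v) (ι (fold v next d))
  from-v zero    = ε
  from-v (suc d) = from-v d ◅◅ Cycle.adjacent around (fold v next d) ◅ ε

  reachable : ∀ x → Star Adj (ι v) x
  reachable = join-elim λ where
    (inj₁ i) → let d , _ , eq = fold-next-reaches v i in subst (Star Adj (ι v) ∘ ι) eq (from-v d)
    (inj₂ l) → adj-join (inj₁ v) (inj₂ l) refl ◅ ε

  -- Uniqueness of the cycle

  module _ {l} (C : Cycle H l) where
    open Cycle C

    z : Fin l → Fin k ⊎ Fin m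
    z i = splitAt k (vertex i)

    z-injective : Injective _≡_ _≡_ z
    z-injective eq = injective (trans (sym (join-splitAt k m _)) (trans (cong (join k m) eq) (join-splitAt k m _)))

    leaf-neighbour : ∀ s f → PendantAdj m v s (inj₂ f) → s ≡ inj₁ v
    leaf-neighbour (inj₁ i) f refl = refl

    leaf-neighbour′ : ∀ s f → PendantAdj m v (inj₂ f) s → s ≡ inj₁ v
    leaf-neighbour′ (inj₁ i) f refl = refl

    -- Both cycle neighbours of a leaf would be `v`, but vertices two steps apart on a cycle of
    -- length at least `3` differ.
    no-leaf : ∀ i f → z (next i) ≢ inj₂ f
    no-leaf i f eq = fold-next≢ i 2 (s≤s z≤n) length≥3 (z-injective (trans
      (leaf-neighbour′ (z (next (next i))) f (subst (λ s → PendantAdj m v s (z (next (next i)))) eq (adjacent (next i))))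
      (sym (leaf-neighbour (z i) f (subst (PendantAdj m v (z i)) eq (adjacent i))))))

    on-cycle : ∀ i → ∃ λ a → z i ≡ inj₁ a
    -- Every index is a successor, which is the form that `no-leaf` requires.
    on-cycle i with fold-next-reaches (next i) i
    ... | d , _ , eq with z i in zi
    ...   | inj₁ a = a , refl
    ...   | inj₂ f = contradiction
            (trans (cong z (trans (sym (fold-next-comm i d)) eq)) zi) (no-leaf (fold i next d) f)

    w : Fin l → Fin k
    w = proj₁ ∘ on-cycle

    vertex≡ : ∀ i → vertex i ≡ ι (w i)
    vertex≡ i = sym (splitAt⁻¹-↑ˡ (proj₂ (on-cycle i)))

    w-injective : Injective _≡_ _≡_ w
    w-injective {i} {j} eq = injective (trans (vertex≡ i) (trans (cong ι eq) (sym (vertex≡ j))))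

    w-adjacent : ∀ i → w (next i) ≡ next (w i) ⊎ w i ≡ next (w (next i))
    w-adjacent i = join-adj (inj₁ (w i)) (inj₁ (w (next i))) (subst₂ Adj (vertex≡ i) (vertex≡ (next i)) (adjacent i))

    no-backtracking : ∀ i → w (next (next i)) ≢ w i
    no-backtracking i = fold-next≢ i 2 (s≤s z≤n) length≥3 ∘ w-injective

    origin : Fin l
    origin = fromℕ< (ℕ.<⇒≤ (ℕ.<⇒≤ length≥3))

    position : ℕ → Fin l
    position = fold origin next

    Traversed : Fin k → Set
    Traversed i = ∃ λ j → (i ≡ w j × next i ≡ w (next j)) ⊎ (i ≡ w (next j) × next i ≡ w j)

    -- The direction of the first step persists, since a reversal would return to the vertex two
    -- steps before.
    forwards : w (next origin) ≡ next (w origin) → ∀ d → w (position (suc d)) ≡ next (w (position d))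
    forwards h zero = h
    forwards h (suc d) with w-adjacent (position (suc d))
    ... | inj₁ eq = eq
    ... | inj₂ eq = contradiction (sym (next-injective (trans (sym (forwards h d)) eq))) (no-backtracking (position d))

    forwards-fold : w (next origin) ≡ next (w origin) → ∀ d → w (position d) ≡ fold (w origin) next d
    forwards-fold h zero    = refl
    forwards-fold h (suc d) = trans (forwards h d) (cong next (forwards-fold h d))

    backwards : w origin ≡ next (w (next origin)) → ∀ d → w (position d) ≡ next (w (position (suc d)))
    backwards h zero = h
    backwards h (suc d) with w-adjacent (position (suc d))
    ... | inj₂ eq = eq
    ... | inj₁ eq = contradiction (trans eq (sym (backwards h d))) (no-backtracking (position d))

    -- Rotating `w (position d)` forward to the origin expresses the backward walk without an
    -- inverse of `next`.
    backwards-fold : w origin ≡ next (w (next origin)) → ∀ d → fold (w (position d)) next d ≡ w origin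
    backwards-fold h zero    = refl
    backwards-fold h (suc d) = begin
      next (fold (w (position (suc d))) next d)  ≡⟨ fold-next-comm _ d ⟨
      fold (next (w (position (suc d)))) next d  ≡⟨ cong (λ i → fold i next d) (backwards h d) ⟨
      fold (w (position d)) next d               ≡⟨ backwards-fold h d ⟩
      w origin                                   ∎
      where open ≡-Reasoning

    traversed : ∀ i → Traversed i
    traversed i with w-adjacent origin
    ... | inj₁ h with fold-next-reaches (w origin) i
    ...   | d , _ , eq = position d , inj₁ (i≡ , trans (cong next i≡) (sym (forwards h d)))
      where
      i≡ : i ≡ w (position d)
      i≡ = trans (sym eq) (sym (forwards-fold h d))
    -- A backward walk meets `next i` first and `i` one step later.
    traversed i | inj₂ h with fold-next-reaches (next i) (w origin)
    ...   | d , _ , eq = position d , inj₂ (next-injective (trans next-i≡ (backwards h d)) , next-i≡)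
      where
      next-i≡ : next i ≡ w (position d)
      next-i≡ = fold-next-injectiveˡ d (trans eq (sym (backwards-fold h d)))

    Joins : (x y a b : Fin (k + m)) → Set
    Joins x y a b = (x ≡ a × y ≡ b) ⊎ (y ≡ a × x ≡ b)

    Joins-sym : ∀ {x y a b} → Joins x y a b → Joins x y b a
    Joins-sym (inj₁ (p , q)) = inj₂ (q , p)
    Joins-sym (inj₂ (p , q)) = inj₁ (q , p)

    edge⁺ : ∀ x y → Edge x y → Cycle.Edge around x y
    edge⁺ x y (i , e) with w-adjacent i
    ... | inj₁ h = w i , subst₂ (Joins x y) (vertex≡ i) (trans (vertex≡ (next i)) (cong ι h)) e
    ... | inj₂ h = w (next i) , Joins-sym
                     (subst₂ (Joins x y) (trans (vertex≡ i) (cong ι h)) (vertex≡ (next i)) e)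

    edge⁻ : ∀ x y → Cycle.Edge around x y → Edge x y
    edge⁻ x y (i , e) with traversed i
    ... | j , inj₁ (p , q) = j , subst₂ (Joins x y) (trans (cong ι p) (sym (vertex≡ j)))
                                   (trans (cong ι q) (sym (vertex≡ (next j)))) e
    ... | j , inj₂ (p , q) = j , Joins-sym (subst₂ (Joins x y) (trans (cong ι p) (sym (vertex≡ (next j))))
                                   (trans (cong ι q) (sym (vertex≡ j))) e)

  unicyclic : Unicyclic H
  unicyclic = record
    { connected = λ x y → reverse symmetric (reachable x) ◅◅ reachable y
    ; girth     = k
    ; cycle     = around
    ; unique    = λ C x y → mk⇔ (edge⁺ C x y) (edge⁻ C x y)
    }

  -- Upper bound for the skew-rank

  module Leaves (σ : Orientation H) (leaf : Fin m) where
    open Orientation σ using (skewAdjacency)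

    cycle-neighbour : ∀ i s → i ≢ v → PendantAdj m v (inj₁ i) s →
                      ∃ λ j → s ≡ inj₁ j × (j ≡ next i ⊎ i ≡ next j)
    cycle-neighbour i (inj₁ j) i≢v adj = j , refl , adj
    cycle-neighbour i (inj₂ f) i≢v i≡v = contradiction i≡v i≢v

    neighbours : ∀ d → suc d < k → ∀ y → Adj (ι (fold v next (suc d))) y →
                 y ≡ ι (fold v next d) ⊎ y ≡ ι (fold v next (suc (suc d)))
    neighbours d d<k = join-elim λ s adj → cases s
      (cycle-neighbour (fold v next (suc d)) s (fold-next≢ v (suc d) (s≤s z≤n) d<k)
        (join-adj (inj₁ (fold v next (suc d))) s adj))
      where
      cases : ∀ s → (∃ λ j → s ≡ inj₁ j × (j ≡ next (fold v next (suc d)) ⊎ next (fold v next d) ≡ next j)) →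
              join k m s ≡ ι (fold v next d) ⊎ join k m s ≡ ι (fold v next (suc (suc d)))
      cases _ (j , refl , inj₁ eq) = inj₂ (cong ι eq)
      cases _ (j , refl , inj₂ eq) = inj₁ (cong ι (sym (next-injective eq)))

    leaf-neighbours : ∀ f x → Adj (k ↑ʳ f) x → x ≡ ι v
    leaf-neighbours f = join-elim λ s adj → cases s (join-adj (inj₂ f) s adj)
      where
      cases : ∀ s → PendantAdj m v (inj₂ f) s → join k m s ≡ ι v
      cases (inj₁ i) refl = refl

    module _ (y : Fin (k + m) → ℚ) where

      leaf-row⁺ : ∀ f → (skewAdjacency · y) (k ↑ʳ f) ≡ 0ℚ → y (ι v) ≡ 0ℚ
      leaf-row⁺ f row≡0 = row-isolates σ id y (k ↑ʳ f) (ι v) row≡0 (adj-join (inj₂ f) (inj₁ v) refl)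
        λ x x≢v adj → contradiction (leaf-neighbours f x adj) x≢v

      leaf-row⁻ : y (ι v) ≡ 0ℚ → ∀ f → (skewAdjacency · y) (k ↑ʳ f) ≡ 0ℚ
      leaf-row⁻ yv≡0 f = row-vanishes σ id y (k ↑ʳ f)
        λ x adj → trans (cong y (leaf-neighbours f x adj)) yv≡0

      -- A single leaf row already forces `y` to vanish at `v`, the only neighbour of each leaf.
      all-rows : (skewAdjacency · y) (k ↑ʳ leaf) ≡ 0ℚ → (∀ i → (skewAdjacency · y) (ι i) ≡ 0ℚ) →
                 ∀ x → (skewAdjacency · y) x ≡ 0ℚ
      all-rows leaf≡0 cycle≡0 = join-elim λ where
        (inj₁ i) → cycle≡0 i
        (inj₂ f) → leaf-row⁻ (leaf-row⁺ leaf leaf≡0) f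

    skewRank-≤-suc : skewRank σ ≤ suc k
    skewRank-≤-suc = rank-≤ skewAdjacency ρ λ y ρ≡0 → all-rows y (ρ≡0 zero) (ρ≡0 ∘ suc)
      where
      ρ : Fin (suc k) → Fin (k + m)
      ρ zero    = k ↑ʳ leaf
      ρ (suc i) = ι i

    module _ (t : ℕ) (k≡ : k ≡ suc t * 2) where

      at : ℕ → Fin k
      at = fold v next

      -- These are `k` rows: one leaf and the cycle vertices `0` to `k - 2` steps after `v`. The row
      -- at `k - 1` steps is left out.
      ρ : Fin (suc (suc (t * 2))) → Fin (k + m)
      ρ zero    = k ↑ʳ leaf
      ρ (suc i) = ι (at (toℕ i))

      ρ-spans : ∀ y → (∀ b → (skewAdjacency · y) (ρ b) ≡ 0ℚ) → ∀ x → (skewAdjacency · y) x ≡ 0ℚ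
      ρ-spans y ρ≡0 = all-rows y (ρ≡0 zero) λ i →
        let d , d<k , eq = fold-next-reaches v i in
        subst (λ i → (skewAdjacency · y) (ι i) ≡ 0ℚ) eq (row d (s≤s⁻¹ (subst (d <_) k≡ d<k)))
        where
        kept : ∀ d → d < suc (t * 2) → (skewAdjacency · y) (ι (at d)) ≡ 0ℚ
        kept d d< = subst (λ d → (skewAdjacency · y) (ι (at d)) ≡ 0ℚ) (toℕ-fromℕ< d<) (ρ≡0 (suc (fromℕ< d<)))

        -- The leaf row gives the entry at `v`; each kept row at an odd position carries the
        -- vanishing two steps further.
        even-entries-vanish : ∀ s → s ≤ t → y (ι (at (s * 2))) ≡ 0ℚ
        even-entries-vanish zero    _   = leaf-row⁺ y leaf (ρ≡0 zero)
        even-entries-vanish (suc s) s<t = row-isolates σ id y (ι (at (suc (s * 2)))) (ι (at (suc s * 2)))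
          (kept (suc (s * 2)) (s≤s (ℕ.<⇒≤ (ℕ.*-monoˡ-≤ 2 s<t))))
          (Cycle.adjacent around (at (suc (s * 2)))) other
          where
          other : ∀ x → x ≢ ι (at (suc s * 2)) → Adj (ι (at (suc (s * 2)))) x → y x ≡ 0ℚ
          other x x≢ adj with neighbours (s * 2)
            (subst (suc (s * 2) <_) (sym k≡) (s≤s (s≤s (ℕ.*-monoˡ-≤ 2 (ℕ.<⇒≤ s<t))))) x adj
          ... | inj₁ refl = even-entries-vanish s (ℕ.<⇒≤ s<t)
          ... | inj₂ x≡   = contradiction x≡ x≢

        -- Both neighbours of this vertex lie at even positions, one of them being `v` itself after
        -- a full turn.
        dropped : (skewAdjacency · y) (ι (at (suc (t * 2)))) ≡ 0ℚ
        dropped = row-vanishes σ id y _ both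
          where
          both : ∀ x → Adj (ι (at (suc (t * 2)))) x → y x ≡ 0ℚ
          both x adj with neighbours (t * 2) (ℕ.≤-reflexive (sym k≡)) x adj
          ... | inj₁ refl = even-entries-vanish t ℕ.≤-refl
          ... | inj₂ x≡   = begin
            y x                         ≡⟨ cong y x≡ ⟩
            y (ι (at (suc t * 2)))      ≡⟨ cong (y ∘ ι ∘ at) k≡ ⟨
            y (ι (at k))                ≡⟨ cong (y ∘ ι) (fold-next-period v) ⟩
            y (ι v)                     ≡⟨ leaf-row⁺ y leaf (ρ≡0 zero) ⟩
            0ℚ                          ∎
            where open ≡-Reasoning

        row : ∀ d → d ≤ suc (t * 2) → (skewAdjacency · y) (ι (at d)) ≡ 0ℚ
        row d d≤ with ℕ.m≤n⇒m<n∨m≡n d≤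
        ... | inj₁ d<  = kept d d<
        ... | inj₂ refl = dropped

      skewRank-≤ : skewRank σ ≤ suc t * 2
      skewRank-≤ = rank-≤ skewAdjacency ρ ρ-spans

    skewRank-≤-even : 2 ∣ k → skewRank σ ≤ k
    skewRank-≤-even (divides zero k≡0)   = contradiction (sym k≡0) (ℕ.<⇒≢ (ℕ.<⇒≤ (ℕ.<⇒≤ 3≤k)))
    skewRank-≤-even (divides (suc t) k≡) = subst (skewRank σ ≤_) (sym k≡) (skewRank-≤ t k≡)

theorem4p3 : (∀ {n} (G : Graph n) (σ : Orientation G) (U : Unicyclic G) → girth U < n →
    (2 ∣ girth U → skewRank σ ≥ girth U) ×
    (¬ 2 ∣ girth U → skewRank σ ≥ suc (girth U)))
    ×
    (∀ {k} (m : ℕ) (v : Fin k) (3≤k : 3 ≤ k) → k < k + m →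
    let H = cycleWithPendants m v 3≤k in
    Orientation H ×
    (Σ[ U ∈ Unicyclic H ] girth U ≡ k) ×
    (∀ (σ : Orientation H) →
    (2 ∣ k → skewRank σ ≡ k) ×
    (¬ 2 ∣ k → skewRank σ ≡ suc k)))
theorem4p3 = skewRank-≥-girth , λ {k} m v 3≤k k<k+m →
  let open Pendants m v 3≤k
      -- `k < k + m` makes `m` positive, so there is a leaf.
      leaf = fromℕ< (ℕ.+-cancelˡ-< k 0 m (subst (_< k + m) (sym (ℕ.+-identityʳ k)) k<k+m))
  in
  natural-orientation H , (unicyclic , refl) , λ σ →
  let open Leaves σ leaf
      even , odd = skewRank-≥-girth H σ unicyclic k<k+m
  in
    (λ 2∣k  → ℕ.≤-antisym (skewRank-≤-even 2∣k) (even 2∣k))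
  , (λ ¬2∣k → ℕ.≤-antisym skewRank-≤-suc (odd ¬2∣k))
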